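{- Let $V$ be a fixed $v$-set and let $\Omega$ be a family of $v$ distinct non-empty subsets of $V$. (a) Suppose $\Omega=\Omega_0,\Omega_1,\dots,\Omega_n=\Omega'$ is a sequence of families with $\Omega_i=h_i(\Omega_{i-1})$ for $i=1,\dots,n$, where each $h_i$ equals $g$ or equals $f_{A_i}$ for some $A_i\in\Omega_{i-1}$ (so that each function is defined on the family to which it is applied). Then $\Omega'=g(\Omega)=\Omega$ or $\Omega'=f_A(\Omega)$ for some $A\in\Omega$. (b) Let $\mathbf{X}$ be the set of all families $\Omega'$ that can be obtained from $\Omega$ by a finite sequence of functions as in part (a), and let $\mathbf{Y}$ be the set of all families $\Omega''$ of the form $\Omega''=h(\Omega)$ where $h=g$ or $h=f_A$ for some $A\in\Omega$. Then $\mathbf{X}=\mathbf{Y}$. (c) For two families $\Omega$ and $\Sigma$ of $v$ distinct non-empty subsets of $V$, write $\Sigma\sim\Omega$ if $\Sigma=h(\Omega)$ where $h=g$ or $h=f_A$ for some $A\in\Omega$. Then $\sim$ is an equivalence relation.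
   Context: $A\bigtriangleup B$ denotes symmetric difference. For a family $\Omega$ of $v$ distinct non-empty subsets of the $v$-set $V$ (members of $\Omega$ are called its blocks) and a block $A\in\Omega$, the block complementation $f_A$ with respect to $A$ is the function on $\Omega$ defined by $f_A(A)=A$ and $f_A(B)=A\bigtriangleup B$ for all $B\in\Omega$, $B\neq A$; $f_A$ is not defined on $\Omega$ if $A\notin\Omega$. The image $f_A(\Omega)=\{f_A(B):B\in\Omega\}$ is again a family of $v$ distinct non-empty subsets of $V$. The function $g$ is the identity function, $g(B)=B$ for every $B\in\Omega$, and it is defined on every family $\Omega$; thus $g(\Omega)=\Omega$. -}

module Defs where

open import Data.Bool.Base using (true; false; _xor_; if_then_else_)
import Data.Bool.Properties as Bool
open import Data.Empty using (⊥-elim)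
open import Data.Fin.Base using (Fin; zero; suc; inject₁; fromℕ)
open import Data.Fin.Subset using (Subset; Nonempty; ⊥) renaming (_∈_ to _∈ₛ_)
open import Data.Fin.Subset.Properties using (nonempty?; Empty-unique; ∉⊥)
open import Data.List.Base using (List; length; map)
open import Data.List.Membership.Propositional using (_∈_)
open import Data.List.Properties using (length-map)
open import Data.List.Relation.Binary.BagAndSetEquality using (_∼[_]_; set)
open import Data.List.Relation.Unary.All as All using (All; []; _∷_)
import Data.List.Relation.Unary.All.Properties as All
open import Data.List.Relation.Unary.AllPairs using ([]; _∷_)
open import Data.List.Relation.Unary.Unique.Propositional using (Unique)
open import Data.Nat.Base using (ℕ; suc)
open import Data.Product.Base using (∃-syntax; _,_)
open import Data.Vec.Base using ([]; _∷_; zipWith)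
open import Data.Vec.Properties using (≡-dec; ∷-injective; zipWith-identityʳ)
open import Relation.Binary.Definitions using (DecidableEquality)
open import Relation.Binary.PropositionalEquality
  using (_≡_; _≢_; refl; sym; trans; cong₂; subst)
open import Relation.Nullary.Decidable using (yes; no; does)
open import Relation.Unary using (Pred)
open import Level using (0ℓ)

infixl 6 _△_
infix 4 _≟_ _≈_ _∼_

_≟_ : ∀ {v} → DecidableEquality (Subset v)
_≟_ = ≡-dec Bool._≟_

_△_ : ∀ {v} → Subset v → Subset v → Subset v
_△_ = zipWith _xor_

-- The v-set V is Fin v. A family is given by a duplicate-free enumeration of
-- its blocks; the order of enumeration is ignored by _≈_ below.
record Family (v : ℕ) : Set where
  field
    blocks   : List (Subset v)
    distinct : Unique blocks
    nonempty : All Nonempty blocks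
    size     : length blocks ≡ v

open Family public

_≈_ : ∀ {v} → Family v → Family v → Set
Ω ≈ Σ = blocks Ω ∼[ set ] blocks Σ

-- The functions defined on Ω: f_A is available only for blocks A of Ω.
data Fun {v : ℕ} (Ω : Family v) : Set where
  g : Fun Ω
  f : (A : Subset v) → A ∈ blocks Ω → Fun Ω

-- Given on all subsets of V for convenience; only its values on Ω matter.
⟦_⟧ : ∀ {v} {Ω : Family v} → Fun Ω → Subset v → Subset v
⟦ g     ⟧ B = B
⟦ f A _ ⟧ B = if does (B ≟ A) then A else A △ B

private
  xor-cancelˡ : ∀ a {b c} → a xor b ≡ a xor c → b ≡ c
  xor-cancelˡ false eq = eq
  xor-cancelˡ true  eq = Bool.not-injective eq

  △-cancelˡ : ∀ {v} (A : Subset v) {B C} → A △ B ≡ A △ C → B ≡ C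
  △-cancelˡ []      {[]}    {[]}    _  = refl
  △-cancelˡ (a ∷ A) {_ ∷ _} {_ ∷ _} eq with ∷-injective eq
  ... | p , q = cong₂ _∷_ (xor-cancelˡ a p) (△-cancelˡ A q)

  A△A≡⊥ : ∀ {v} (A : Subset v) → A △ A ≡ ⊥
  A△A≡⊥ []      = refl
  A△A≡⊥ (a ∷ A) = cong₂ _∷_ (Bool.xor-same a) (A△A≡⊥ A)

  A△⊥≡A : ∀ {v} (A : Subset v) → A △ ⊥ ≡ A
  A△⊥≡A = zipWith-identityʳ Bool.xor-identityʳ

  A△B≢A : ∀ {v} {A B : Subset v} → Nonempty B → A △ B ≢ A
  A△B≢A {A = A} (_ , x∈B) eq =
    ∉⊥ (subst (_ ∈ₛ_) (△-cancelˡ A (trans eq (sym (A△⊥≡A A)))) x∈B)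

module _ {v : ℕ} {Ω : Family v} where

  ⟦⟧-nonempty : (h : Fun Ω) {B : Subset v} → Nonempty B → Nonempty (⟦ h ⟧ B)
  ⟦⟧-nonempty g       B≠∅ = B≠∅
  ⟦⟧-nonempty (f A _) {B} B≠∅ with B ≟ A
  ... | yes refl = B≠∅
  ... | no  B≢A  with nonempty? (A △ B)
  ...   | yes ne = ne
  ...   | no  e  = ⊥-elim (B≢A (△-cancelˡ A (trans (Empty-unique e) (sym (A△A≡⊥ A)))))

  ⟦⟧-injective : (h : Fun Ω) {B C : Subset v} → Nonempty B → Nonempty C →
                 ⟦ h ⟧ B ≡ ⟦ h ⟧ C → B ≡ C
  ⟦⟧-injective g       _   _   eq = eq
  ⟦⟧-injective (f A _) {B} {C} B≠∅ C≠∅ eq with B ≟ A | C ≟ A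
  ... | yes refl | yes refl = refl
  ... | yes refl | no  _    = ⊥-elim (A△B≢A C≠∅ (sym eq))
  ... | no  _    | yes refl = ⊥-elim (A△B≢A B≠∅ eq)
  ... | no  _    | no  _    = △-cancelˡ A eq

  map-unique : (h : Fun Ω) {Bs : List (Subset v)} →
               All Nonempty Bs → Unique Bs → Unique (map ⟦ h ⟧ Bs)
  map-unique h []           []         = []
  map-unique h (B≠∅ ∷ Bs≠∅) (B∉Bs ∷ u) =
    All.map⁺ (All.zipWith (λ (C≠∅ , B≢C) eq → B≢C (⟦⟧-injective h B≠∅ C≠∅ eq)) (Bs≠∅ , B∉Bs))
    ∷ map-unique h Bs≠∅ u

-- h(Ω) = { h(B) : B ∈ Ω }
image : ∀ {v} (Ω : Family v) → Fun Ω → Family v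
image Ω h = record
  { blocks   = map ⟦ h ⟧ (blocks Ω)
  ; distinct = map-unique h (nonempty Ω) (distinct Ω)
  ; nonempty = All.map⁺ (All.map (⟦⟧-nonempty h) (nonempty Ω))
  ; size     = trans (length-map ⟦ h ⟧ (blocks Ω)) (size Ω)
  }

record Sequence {v : ℕ} (n : ℕ) (Ω Ω′ : Family v) : Set where
  field
    Ωs    : Fin (suc n) → Family v
    start : Ωs zero ≈ Ω
    end   : Ωs (fromℕ n) ≈ Ω′
    step  : (i : Fin n) → ∃[ h ] Ωs (suc i) ≈ image (Ωs (inject₁ i)) h

_∼_ : ∀ {v} → Family v → Family v → Set
Σ ∼ Ω = ∃[ h ] Σ ≈ image Ω h

𝐗 : ∀ {v} → Family v → Pred (Family v) 0ℓ
𝐗 Ω Ω′ = ∃[ n ] Sequence n Ω Ω′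

𝐘 : ∀ {v} → Family v → Pred (Family v) 0ℓ
𝐘 Ω Ω″ = ∃[ h ] Ω″ ≈ image Ω h

{-# OPTIONS --safe #-}

-- Write Ω⁺ = Ω ∪ {∅}. The image f_A(Ω) satisfies f_A(Ω)⁺ = A △ Ω⁺, and g(Ω)⁺ = ∅ △ Ω⁺,
-- so Σ ∼ Ω says exactly that Σ⁺ is the translate of Ω⁺ by one of its own elements.
-- Such translations are closed under inversion and composition because △ is the
-- operation of an elementary abelian 2-group.
module Submission where

open import Defs
open import Data.Bool.Properties
  using (xor-assoc; xor-same; xor-identityˡ; xor-identityʳ)
open import Data.Fin.Base using (zero; suc; inject₁; fromℕ)
open import Data.Fin.Induction using (<-weakInduction)
open import Data.Fin.Subset using (Subset; ⊥)
open import Data.Fin.Subset.Properties using (∉⊥)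
open import Data.List.Base using (List; _∷_)
open import Data.List.Membership.Propositional using (_∈_; _∉_)
open import Data.List.Membership.Propositional.Properties using (∈-map⁺; ∈-map⁻)
open import Data.List.Properties using (map-id)
import Data.List.Relation.Unary.All as All
open import Data.List.Relation.Unary.Any using (here; there)
open import Data.Nat.Base using (ℕ)
open import Data.Product.Base using (_×_; _,_; ∃-syntax; Σ-syntax)
open import Data.Sum.Base using (_⊎_; inj₁; inj₂)
open import Data.Vec.Base using ([]; _∷_)
open import Data.Vec.Properties using (zipWith-assoc; zipWith-identityˡ; zipWith-identityʳ)
open import Function.Base using (case_of_)
open import Function.Bundles using (_⇔_; mk⇔; module Equivalence)
open import Function.Properties.Equivalence using (⇔-isEquivalence)
open import Level using (0ℓ)
open import Relation.Binary.PropositionalEquality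
open import Relation.Binary.Structures using (IsEquivalence)
open import Relation.Nullary.Decidable using (yes; no)
open import Relation.Nullary.Negation using (contradiction)
open import Relation.Unary using (_≐_)

open Equivalence using (to; from)
private module ⇔ = IsEquivalence (⇔-isEquivalence {0ℓ})

private variable
  v : ℕ

△-assoc : (A B C : Subset v) → (A △ B) △ C ≡ A △ (B △ C)
△-assoc = zipWith-assoc xor-assoc

△-identityˡ : (A : Subset v) → ⊥ △ A ≡ A
△-identityˡ = zipWith-identityˡ xor-identityˡ

△-identityʳ : (A : Subset v) → A △ ⊥ ≡ A
△-identityʳ = zipWith-identityʳ xor-identityʳ

△-self : (A : Subset v) → A △ A ≡ ⊥
△-self []      = refl
△-self (a ∷ A) = cong₂ _∷_ (xor-same a) (△-self A)

△-involutive : (A B : Subset v) → A △ (A △ B) ≡ B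
△-involutive A B = begin
  A △ (A △ B)  ≡⟨ △-assoc A A B ⟨
  (A △ A) △ B  ≡⟨ cong (_△ B) (△-self A) ⟩
  ⊥ △ B        ≡⟨ △-identityˡ B ⟩
  B            ∎
  where open ≡-Reasoning

infix 8 _⁺

_⁺ : Family v → List (Subset v)
Ω ⁺ = ⊥ ∷ blocks Ω

⊥∉blocks : (Ω : Family v) → ⊥ ∉ blocks Ω
⊥∉blocks Ω ⊥∈Ω with All.lookup (nonempty Ω) ⊥∈Ω
... | _ , x∈⊥ = ∉⊥ x∈⊥

≈⇒⁺ : (Σ Ω : Family v) → Σ ≈ Ω → ∀ {X} → X ∈ Σ ⁺ ⇔ X ∈ Ω ⁺
≈⇒⁺ Σ Ω Σ≈Ω = mk⇔
  (λ { (here eq) → here eq ; (there X∈Σ) → there (to Σ≈Ω X∈Σ) })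
  (λ { (here eq) → here eq ; (there X∈Ω) → there (from Σ≈Ω X∈Ω) })

-- No block is empty, so the adjoined `⊥` can be cancelled from both sides.
⁺⇒≈ : (Σ Ω : Family v) → (∀ {X} → X ∈ Σ ⁺ ⇔ X ∈ Ω ⁺) → Σ ≈ Ω
⁺⇒≈ Σ Ω Σ⁺⇔Ω⁺ = mk⇔
  (λ X∈Σ → drop Σ Ω X∈Σ (to Σ⁺⇔Ω⁺ (there X∈Σ)))
  (λ X∈Ω → drop Ω Σ X∈Ω (from Σ⁺⇔Ω⁺ (there X∈Ω)))
  where
  drop : ∀ Φ Ψ {X} → X ∈ blocks Φ → X ∈ Ψ ⁺ → X ∈ blocks Ψ
  drop Φ Ψ X∈Φ (here refl) = contradiction X∈Φ (⊥∉blocks Φ)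
  drop Φ Ψ X∈Φ (there X∈Ψ) = X∈Ψ

image-g : (Ω : Family v) → image Ω g ≈ Ω
image-g Ω = ⇔.reflexive (cong (_ ∈_) (map-id (blocks Ω)))

shift : {Ω : Family v} → Fun Ω → Subset v
shift g       = ⊥
shift (f A _) = A

shift∈⁺ : {Ω : Family v} (h : Fun Ω) → shift h ∈ Ω ⁺
shift∈⁺ g         = here refl
shift∈⁺ (f A A∈Ω) = there A∈Ω

-- Since `A △_` is an involution, membership of `X` in the translate by `A` can be tested by moving
-- `X` back into `Ω ⁺`. For `f A _`, translation exchanges `⊥` and `A` and agrees with the block
-- complementation on every other block; as a set, the translate therefore still contains both `⊥`
-- and `A`.
image⁺ : (Ω : Family v) (h : Fun Ω) → ∀ {X} → X ∈ image Ω h ⁺ ⇔ shift h △ X ∈ Ω ⁺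
image⁺ Ω g {X} = ⇔.trans (≈⇒⁺ (image Ω g) Ω (image-g Ω))
  (⇔.reflexive (cong (_∈ Ω ⁺) (sym (△-identityˡ X))))
image⁺ Ω h@(f A A∈Ω) {X} = mk⇔ ⇒ ⇐
  where
  ⇒ : X ∈ image Ω h ⁺ → A △ X ∈ Ω ⁺
  ⇒ (here refl) = there (subst (_∈ blocks Ω) (sym (△-identityʳ A)) A∈Ω)
  ⇒ (there X∈) with ∈-map⁻ ⟦ h ⟧ X∈
  ... | B , B∈Ω , X≡hB with B ≟ A
  -- The fixed block `A` of the image is matched with the adjoined `⊥` of `Ω ⁺`, not with the block
  -- `A`.
  ...   | yes refl = here (trans (cong (A △_) X≡hB) (△-self A))
  ...   | no  _    = there (subst (_∈ blocks Ω)
                       (sym (trans (cong (A △_) X≡hB) (△-involutive A B))) B∈Ω)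

  h[A]≡A : ⟦ h ⟧ A ≡ A
  h[A]≡A with A ≟ A
  ... | yes _   = refl
  ... | no  A≢A = contradiction refl A≢A

  h[B]≡A△B : ∀ {B} → B ≢ A → ⟦ h ⟧ B ≡ A △ B
  h[B]≡A△B {B} B≢A with B ≟ A
  ... | yes B≡A = contradiction B≡A B≢A
  ... | no  _   = refl

  ⇐ : A △ X ∈ Ω ⁺ → X ∈ image Ω h ⁺
  ⇐ (here A△X≡⊥) = there (subst (_∈ blocks (image Ω h)) (trans h[A]≡A A≡X) (∈-map⁺ ⟦ h ⟧ A∈Ω))
    where
    A≡X : A ≡ X
    A≡X = trans (sym (△-identityʳ A)) (trans (cong (A △_) (sym A△X≡⊥)) (△-involutive A X))
  -- If the block `A △ X` is `A` itself, then `X` is `⊥`, the adjoined element; otherwise `h` sends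
  -- this block to `A △ (A △ X)`, which is `X`.
  ⇐ (there A△X∈Ω) = case A △ X ≟ A of λ where
    (yes A△X≡A) → here (trans (sym (△-involutive A X)) (trans (cong (A △_) A△X≡A) (△-self A)))
    (no  A△X≢A) → there (subst (_∈ blocks (image Ω h))
      (trans (h[B]≡A△B A△X≢A) (△-involutive A X)) (∈-map⁺ ⟦ h ⟧ A△X∈Ω))

-- A form of `_∼_` without a case split between `g` and `f`, so that symmetry and transitivity
-- reduce to group laws.
Translate : Family v → Family v → Set
Translate Σ Ω = ∃[ A ] A ∈ Ω ⁺ × (∀ {X} → X ∈ Σ ⁺ ⇔ A △ X ∈ Ω ⁺)

∼⇒Translate : (Σ Ω : Family v) → Σ ∼ Ω → Translate Σ Ω
∼⇒Translate Σ Ω (h , Σ≈hΩ) =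
  shift h , shift∈⁺ h , ⇔.trans (≈⇒⁺ Σ (image Ω h) Σ≈hΩ) (image⁺ Ω h)

-- The position of the translating element in `Ω ⁺` selects the function: the head gives `g`, the
-- tail a block complementation.
Translate⇒∼ : (Σ Ω : Family v) → Translate Σ Ω → Σ ∼ Ω
Translate⇒∼ Σ Ω (A , here refl , Σ⁺⇔) =
  g , ⁺⇒≈ Σ (image Ω g) (⇔.trans Σ⁺⇔ (⇔.sym (image⁺ Ω g)))
Translate⇒∼ Σ Ω (A , there A∈Ω , Σ⁺⇔) =
  f A A∈Ω , ⁺⇒≈ Σ (image Ω (f A A∈Ω)) (⇔.trans Σ⁺⇔ (⇔.sym (image⁺ Ω (f A A∈Ω))))

-- The same `A` translates back, being its own inverse; it lies in `Σ ⁺` because `A △ A` is `⊥`,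
-- which is in `Ω ⁺`.
Translate-sym : (Σ Ω : Family v) → Translate Σ Ω → Translate Ω Σ
Translate-sym Σ Ω (A , _ , Σ⁺⇔) =
  A , from Σ⁺⇔ (here (△-self A)) ,
  λ {X} → ⇔.trans (⇔.reflexive (cong (_∈ Ω ⁺) (sym (△-involutive A X)))) (⇔.sym Σ⁺⇔)

-- The translations compose to the one by `B △ A`. This element is in `Ω ⁺` because `A` is in `Σ ⁺`,
-- whose elements are carried into `Ω ⁺` by `B`.
Translate-trans : (Φ Σ Ω : Family v) → Translate Φ Σ → Translate Σ Ω → Translate Φ Ω
Translate-trans Φ Σ Ω (A , A∈Σ⁺ , Φ⁺⇔) (B , _ , Σ⁺⇔) =
  B △ A , to Σ⁺⇔ A∈Σ⁺ ,
  λ {X} → ⇔.trans Φ⁺⇔ (⇔.trans Σ⁺⇔ (⇔.reflexive (cong (_∈ Ω ⁺) (sym (△-assoc B A X)))))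

≈⇒∼ : (Σ Ω : Family v) → Σ ≈ Ω → Σ ∼ Ω
≈⇒∼ Σ Ω Σ≈Ω = g , ⇔.trans Σ≈Ω (⇔.sym (image-g Ω))

∼-sym : (Σ Ω : Family v) → Σ ∼ Ω → Ω ∼ Σ
∼-sym Σ Ω Σ∼Ω = Translate⇒∼ Ω Σ (Translate-sym Σ Ω (∼⇒Translate Σ Ω Σ∼Ω))

∼-trans : (Φ Σ Ω : Family v) → Φ ∼ Σ → Σ ∼ Ω → Φ ∼ Ω
∼-trans Φ Σ Ω Φ∼Σ Σ∼Ω = Translate⇒∼ Φ Ω
  (Translate-trans Φ Σ Ω (∼⇒Translate Φ Σ Φ∼Σ) (∼⇒Translate Σ Ω Σ∼Ω))

∼-isEquivalence : IsEquivalence (_∼_ {v})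
∼-isEquivalence = record
  { refl  = λ {Ω} → ≈⇒∼ Ω Ω ⇔.refl
  ; sym   = λ {Σ} {Ω} → ∼-sym Σ Ω
  ; trans = λ {Φ} {Σ} {Ω} → ∼-trans Φ Σ Ω
  }

Sequence⇒∼ : (Ω Ω′ : Family v) {n : ℕ} → Sequence n Ω Ω′ → Ω′ ∼ Ω
Sequence⇒∼ Ω Ω′ {n} s =
  ∼-trans Ω′ (Ωs (fromℕ n)) Ω (≈⇒∼ Ω′ (Ωs (fromℕ n)) (⇔.sym end))
    -- Induction along the sequence relates every term to `Ω`; the two endpoints, given only up to
    -- `_≈_`, are absorbed as applications of `g`.
    (<-weakInduction (λ i → Ωs i ∼ Ω) (≈⇒∼ (Ωs zero) Ω start)
      (λ i → ∼-trans (Ωs (suc i)) (Ωs (inject₁ i)) Ω (step i)) (fromℕ n))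
  where open Sequence s

∼⇒Sequence : (Ω Ω′ : Family v) → Ω′ ∼ Ω → Sequence 1 Ω Ω′
∼⇒Sequence Ω Ω′ Ω′∼Ω = record
  { Ωs    = λ { zero → Ω ; (suc _) → Ω′ }
  ; start = ⇔.refl
  ; end   = ⇔.refl
  ; step  = λ { zero → Ω′∼Ω }
  }

∼⇒g⊎f : (Ω Ω′ : Family v) → Ω′ ∼ Ω →
        (Ω′ ≈ image Ω g × image Ω g ≈ Ω) ⊎ (∃[ A ] Σ[ A∈Ω ∈ A ∈ blocks Ω ] Ω′ ≈ image Ω (f A A∈Ω))
∼⇒g⊎f Ω Ω′ (g       , Ω′≈gΩ) = inj₁ (Ω′≈gΩ , image-g Ω)
∼⇒g⊎f Ω Ω′ (f A A∈Ω , Ω′≈fΩ) = inj₂ (A , A∈Ω , Ω′≈fΩ)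

theorem2p4 : (v : ℕ) →
    ((Ω Ω′ : Family v) (n : ℕ) → Sequence n Ω Ω′ →
    (Ω′ ≈ image Ω g × image Ω g ≈ Ω) ⊎ (∃[ A ] Σ[ A∈Ω ∈ A ∈ blocks Ω ] Ω′ ≈ image Ω (f A A∈Ω)))
    × ((Ω : Family v) → 𝐗 Ω ≐ 𝐘 Ω)
    × IsEquivalence (_∼_ {v})
theorem2p4 v =
  (λ Ω Ω′ n s → ∼⇒g⊎f Ω Ω′ (Sequence⇒∼ Ω Ω′ s)) ,
  -- `𝐘 Ω Ω′` unfolds to `Ω′ ∼ Ω`, so one inclusion collapses a sequence and the other uses a
  -- sequence of length one.
  (λ Ω → (λ {Ω′} (_ , s) → Sequence⇒∼ Ω Ω′ s) , (λ {Ω′} Ω′∼Ω → 1 , ∼⇒Sequence Ω Ω′ Ω′∼Ω)) ,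
  ∼-isEquivalence
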